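{- Every directed graph $D$ on $n$ vertices has at most $\mathcal{O}^*(1.4549^n)$ inclusion-wise minimal knot-free vertex deletion sets. Moreover, there is an infinite family of directed graphs such that each member on $n$ vertices has $\Omega(1.4422^n)$ inclusion-wise minimal knot-free vertex deletion sets.
   Context: All digraphs are finite, without loops or parallel arcs. A knot in a digraph $D$ is a strongly connected component $K$ with $|V(K)|\ge 2$ such that there is no arc $(u,v)$ with $u\in V(K)$ and $v\notin V(K)$. $D$ is knot-free if it contains no knot. A knot-free vertex deletion set of $D$ is a set $S\subseteq V(D)$ such that the subgraph $D-S$ induced on $V(D)\setminus S$ is knot-free; it is inclusion-wise minimal if no proper subset of it is a knot-free vertex deletion set. $\mathcal{O}^*(\cdot)$ suppresses factors polynomial in $n$. -}

module Defs where

open import Data.Nat using (ℕ; _≤_)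
open import Data.Bool using (Bool; true; false)
open import Data.Fin using (Fin)
open import Data.Fin.Subset using (Subset; _∈_; _∉_; _⊆_; _⊂_; ∁; ∣_∣; Nonempty)
open import Data.Product using (_×_)
open import Relation.Binary.PropositionalEquality using (_≡_)
open import Relation.Nullary using (¬_)

record Digraph (n : ℕ) : Set where
  field
    adj      : Fin n → Fin n → Bool
    loopless : ∀ i → adj i i ≡ false
open Digraph public

module _ {n : ℕ} (D : Digraph n) where

  data Reach (X : Subset n) : Fin n → Fin n → Set where
    here : ∀ {u} → u ∈ X → Reach X u u
    step : ∀ {u w v} → u ∈ X → adj D u w ≡ true → Reach X w v → Reach X u v

  record SCC (X K : Subset n) : Set where
    field
      sub      : K ⊆ X
      nonempty : Nonempty K
      strong   : ∀ {u v} → u ∈ K → v ∈ K → Reach X u v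
      maximal  : ∀ {u v} → u ∈ K → v ∈ X → Reach X u v → Reach X v u → v ∈ K

  record Knot (X K : Subset n) : Set where
    field
      scc     : SCC X K
      size    : 2 ≤ ∣ K ∣
      closed  : ∀ {u v} → u ∈ K → v ∈ X → adj D u v ≡ true → v ∈ K

  KnotFree : Subset n → Set
  KnotFree X = ∀ K → ¬ Knot X K

  KFVDS : Subset n → Set
  KFVDS S = KnotFree (∁ S)

  MinimalKFVDS : Subset n → Set
  MinimalKFVDS S = KFVDS S × (∀ S′ → S′ ⊂ S → ¬ KFVDS S′)

{-# OPTIONS --safe #-}

-- Let S be a minimal KFVDS and Z the set of sinks of D - S, so that every vertex of D - S
-- reaches Z.  By minimality S = N⁺(Z), and whatever reaches a vertex z of Z in D - N⁺(z)
-- already lies in D - S.  Hence, in the graph that joins z to x whenever z ⟶ x or x reaches z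
-- in D - N⁺(z), the set Z is a maximal independent set; it determines S.  The Moon–Moser
-- branching (some vertex of the least closed neighbourhood belongs to Z) then bounds the
-- number of such Z, as k ≤ 1.4549 ^ k for all k.  Disjoint directed triangles attain 3 ^ (n / 3).

module Submission where

open import Data.Bool using (true; false)
open import Data.Bool.Properties using () renaming (_≟_ to _≟ᵇ_)
open import Data.Fin using (Fin; zero; suc; _↑ˡ_)
open import Data.Fin.Patterns using (0F; 1F; 2F)
open import Data.Fin.Properties using (any?; injective⇒≤) renaming (_≟_ to _≟ᶠ_)
open import Data.Fin.Subset
  using (Subset; _∈_; _∉_; _⊆_; _⊂_; ∁; ∣_∣; _-_; _─_; ⊥; ⁅_⁆; inside; outside)
open import Data.Fin.Subset.Properties
open import Data.List using (List; []; _∷_; length; map; _++_; filter; lookup; allFin; cartesianProductWith)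
open import Data.List.Extrema.Nat using (argmin; argmin-sel; f[argmin]≤f[⊤]; f[argmin]≤f[xs])
open import Data.List.Membership.Propositional using (lose; find) renaming (_∈_ to _∈ˡ_)
open import Data.List.Membership.Propositional.Properties using (∈-filter⁺; ∈-filter⁻; ∈-lookup; ∈-allFin)
open import Data.List.Properties using (length-map; length-++; length-tabulate; filter-notAll)
open import Data.List.Relation.Unary.All as All using (All; []; _∷_)
import Data.List.Relation.Unary.All.Properties as All
open import Data.List.Relation.Unary.AllPairs using ([]; _∷_)
open import Data.List.Relation.Unary.Any as Any using (Any; here; there)
import Data.List.Relation.Unary.Any.Properties as Any
open import Data.List.Relation.Unary.Unique.Propositional using (Unique)
import Data.List.Relation.Unary.Unique.Propositional.Properties as Unique
open import Data.Nat using (ℕ; zero; suc; _+_; _*_; _^_; _∸_; _≤_; z≤n; s≤s; _≤?_)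
open import Data.Nat.Properties
open import Data.Product using (Σ; ∃; ∃-syntax; _×_; _,_; proj₁; proj₂)
open import Data.Sum using (_⊎_; inj₁; inj₂; [_,_]′; swap)
open import Data.Vec as Vec using ([]; _∷_; here; there; tabulate)
open import Data.Vec.Properties using (lookup∘tabulate; lookup⇒[]=; []=⇒lookup; ++-injective)
open import Function using (_∘_; _⇔_; mk⇔; Equivalence)
open import Relation.Binary using (Decidable; Reflexive; Symmetric)
open import Relation.Binary.PropositionalEquality
open import Relation.Nullary using (¬_; Dec; yes; no; does; contradiction; ¬?; _×-dec_; _⊎-dec_)
open import Relation.Nullary.Decidable using (dec-true; decidable-stable; from-yes) renaming (map′ to mapᵈ)
import Relation.Unary as Unary
open import Defs

-- Arithmetic and counting in lists

-- Passing from `k` to `k + 1` multiplies the left side by `q * (k + 1) / k`, which is at most `p`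
-- from `k = 3` on because `4 * q ≤ 3 * p`. The cases 2 and 3 come from the hypotheses.
k*q^k≤p^k : ∀ {p q} → q ≤ p → 2 * q ^ 2 ≤ p ^ 2 → 3 * q ^ 3 ≤ p ^ 3 → 4 * q ≤ 3 * p →
            ∀ k → k * q ^ k ≤ p ^ k
k*q^k≤p^k {p} {q} q≤p two three slope = go
  where
  open ≤-Reasoning
  go : ∀ k → k * q ^ k ≤ p ^ k
  go 0 = z≤n
  go 1 = ≤-trans (≤-reflexive (*-identityˡ (q ^ 1))) (*-monoˡ-≤ 1 q≤p)
  go 2 = two
  go 3 = three
  go (suc k@(suc (suc (suc j)))) = begin
    (4 + j) * (q * q ^ k)       ≡⟨ sym (*-assoc (4 + j) q _) ⟩
    (4 + j) * q * q ^ k         ≤⟨ *-monoˡ-≤ (q ^ k) ratio ⟩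
    (3 + j) * p * q ^ k         ≡⟨ cong (_* q ^ k) (*-comm (3 + j) p) ⟩
    p * (3 + j) * q ^ k         ≡⟨ *-assoc p (3 + j) _ ⟩
    p * ((3 + j) * q ^ k)       ≤⟨ *-monoʳ-≤ p (go k) ⟩
    p * p ^ k                   ∎
    where
    ratio : (4 + j) * q ≤ (3 + j) * p
    ratio = begin
      (4 + j) * q     ≡⟨ *-distribʳ-+ q 4 j ⟩
      4 * q + j * q   ≤⟨ +-mono-≤ slope (*-monoʳ-≤ j q≤p) ⟩
      3 * p + j * p   ≡⟨ sym (*-distribʳ-+ p 3 j) ⟩
      (3 + j) * p     ∎

Unique⇒lookup-injective : ∀ {A : Set} {xs : List A} → Unique xs →
                          ∀ {i j} → lookup xs i ≡ lookup xs j → i ≡ j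
Unique⇒lookup-injective (_  ∷ _)  {zero}  {zero}  _  = refl
Unique⇒lookup-injective (≢s ∷ _)  {zero}  {suc j} eq = contradiction eq (All.lookup ≢s (∈-lookup j))
Unique⇒lookup-injective (≢s ∷ _)  {suc i} {zero}  eq = contradiction (sym eq) (All.lookup ≢s (∈-lookup i))
Unique⇒lookup-injective (_  ∷ un) {suc i} {suc j} eq = cong suc (Unique⇒lookup-injective un eq)

Unique-⊆⇒length≤ : ∀ {A : Set} {xs ys : List A} → Unique xs → All (_∈ˡ ys) xs → length xs ≤ length ys
Unique-⊆⇒length≤ {xs = xs} {ys} un sub = injective⇒≤ {f = position} λ {i} {j} eq →
  Unique⇒lookup-injective un (trans (found i) (trans (cong (lookup ys) eq) (sym (found j))))
  where
  position : Fin (length xs) → Fin (length ys)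
  position i = Any.index (All.lookup sub (∈-lookup i))
  found : ∀ i → lookup xs i ≡ lookup ys (position i)
  found i = Any.lookup-index (All.lookup sub (∈-lookup i))

length-filter-complement : ∀ {A : Set} {P : A → Set} (P? : Unary.Decidable P) xs →
  length (filter (¬? ∘ P?) xs) + length (filter P? xs) ≡ length xs
length-filter-complement P? [] = refl
length-filter-complement P? (x ∷ xs) with P? x
... | yes _ = trans (+-suc _ _) (cong suc (length-filter-complement P? xs))
... | no  _ = cong suc (length-filter-complement P? xs)

-- Moon-Moser enumeration of maximal independent sets

module MaximalIndependentSets {A : Set} {_~_ : A → A → Set} (_~?_ : Decidable _~_)
  (~-refl : Reflexive _~_) (~-sym : Symmetric _~_)
  (p q : ℕ) (q≤p : q ≤ p) (k*q^k≤p^k : ∀ k → k * q ^ k ≤ p ^ k) where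

  -- As `_~_` is reflexive, neighbourhoods are closed: every member of `Z` dominates itself, and
  -- independence says that related members coincide.
  record MaximalIndependent (U : List A) (Z : A → Set) : Set where
    field
      sub         : ∀ {x} → Z x → x ∈ˡ U
      independent : ∀ {x y} → Z x → Z y → x ~ y → x ≡ y
      dominating  : ∀ {x} → x ∈ˡ U → ∃[ z ] Z z × z ~ x
  open MaximalIndependent

  -- Sets are predicates and are matched with lists extensionally, so that order and repetition in a
  -- list do not matter.
  Lists : List (List A) → ((A → Set) → Set) → Set₁
  Lists M Q = ∀ Z → Q Z → Any (λ zs → ∀ x → Z x ⇔ x ∈ˡ zs) M

  -- The count is at most `k * (p / q) ^ m`, with denominators cleared to stay in `ℕ`. Completeness
  -- goes one way: a candidate may represent no member of `Q`, or one that another candidate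
  -- represents too.
  record Bounded (k m : ℕ) (Q : (A → Set) → Set) : Set₁ where
    constructor bounded
    field
      candidates : List (List A)
      few        : length candidates * q ^ m ≤ k * p ^ m
      complete   : Lists candidates Q

  nbh : A → List A → List A
  nbh v = filter (v ~?_)

  rest : A → List A → List A
  rest v = filter (¬? ∘ (v ~?_))

  -- Since `p / q` is at least 1, the bound grows with `m`. This brings branches with residual lists
  -- of different lengths to a common exponent.
  Bounded-weaken : ∀ {Q m m′} → m ≤ m′ → Bounded 1 m Q → Bounded 1 m′ Q
  Bounded-weaken {m = m} {m′} m≤m′ (bounded M ≤p lists) = bounded M bound lists
    where
    open ≤-Reasoning
    d = m′ ∸ m
    bound : length M * q ^ m′ ≤ 1 * p ^ m′
    bound = begin
      length M * q ^ m′         ≡⟨ cong (λ i → length M * q ^ i) (sym (m+[n∸m]≡n m≤m′)) ⟩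
      length M * q ^ (m + d)    ≡⟨ cong (length M *_) (^-distribˡ-+-* q m d) ⟩
      length M * (q ^ m * q ^ d) ≡⟨ sym (*-assoc (length M) _ _) ⟩
      length M * q ^ m * q ^ d  ≤⟨ *-mono-≤ ≤p (^-monoˡ-≤ d q≤p) ⟩
      1 * p ^ m * p ^ d         ≡⟨ *-assoc 1 (p ^ m) _ ⟩
      1 * (p ^ m * p ^ d)       ≡⟨ cong (1 *_) (sym (^-distribˡ-+-* p m d)) ⟩
      1 * p ^ (m + d)           ≡⟨ cong (λ i → 1 * p ^ i) (m+[n∸m]≡n m≤m′) ⟩
      1 * p ^ m′                ∎

  -- A maximal independent set through `w` meets the closed neighbourhood of `w` in `w` alone, and
  -- what remains of it is maximal independent in `rest w U`. Prepending `w` therefore turns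
  -- candidates for the residual list into candidates for `U`.
  insert : ∀ {w U m} → w ∈ˡ U → Bounded 1 m (MaximalIndependent (rest w U)) →
           Bounded 1 m (λ Z → MaximalIndependent U Z × Z w)
  insert {w} {U} {m} w∈U (bounded M ≤p lists) = bounded
    (map (w ∷_) M)
    (subst (λ l → l * q ^ m ≤ 1 * p ^ m) (sym (length-map (w ∷_) M)) ≤p)
    λ Z (mis , Zw) → Any.map⁺ (Any.map
      (λ rep x → mk⇔ (to Z mis Zw rep) (from Z Zw rep))
      (lists _ (residual Z mis Zw)))
    where
    module _ (Z : A → Set) where
      Z′ : A → Set
      Z′ x = Z x × ¬ (w ~ x)

      residual : MaximalIndependent U Z → Z w → MaximalIndependent (rest w U) Z′
      residual mis Zw .sub (Zx , ≁) = ∈-filter⁺ _ (mis .sub Zx) ≁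
      residual mis Zw .independent (Zx , _) (Zy , _) = mis .independent Zx Zy
      residual mis Zw .dominating x∈ with ∈-filter⁻ (¬? ∘ (w ~?_)) {xs = U} x∈
      ... | x∈U , w≁x with mis .dominating x∈U
      -- The dominator `z` survives: if it were adjacent to `w`, independence would make it equal to
      -- `w`, which does not dominate `x`.
      ... | z , Zz , z~x = z , (Zz , λ w~z → w≁x (subst (_~ _) (sym (mis .independent Zw Zz w~z)) z~x)) , z~x

      to : MaximalIndependent U Z → Z w → ∀ {zs} → (∀ x → Z′ x ⇔ x ∈ˡ zs) →
           ∀ {x} → Z x → x ∈ˡ w ∷ zs
      to mis Zw rep {x} Zx with w ~? x
      ... | yes w~x = here (sym (mis .independent Zw Zx w~x))
      ... | no  w≁x = there (Equivalence.to (rep _) (Zx , w≁x))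

      from : Z w → ∀ {zs} → (∀ x → Z′ x ⇔ x ∈ˡ zs) → ∀ {x} → x ∈ˡ w ∷ zs → Z x
      from Zw rep (here refl) = Zw
      from Zw rep (there x∈) = proj₁ (Equivalence.from (rep _) x∈)

  collect : ∀ {Q : A → (A → Set) → Set} {m} ws → All (λ w → Bounded 1 m (Q w)) ws →
            Bounded (length ws) m (λ Z → Any (λ w → Q w Z) ws)
  collect [] [] = bounded [] z≤n λ _ ()
  collect {Q} {m} (w ∷ ws) (bounded M ≤p lists ∷ bs) with collect {Q} ws bs
  ... | bounded M′ ≤p′ lists′ = bounded (M ++ M′) bound both
    where
    open ≤-Reasoning
    bound : length (M ++ M′) * q ^ m ≤ suc (length ws) * p ^ m
    bound = begin
      length (M ++ M′) * q ^ m                ≡⟨ cong (_* q ^ m) (length-++ M) ⟩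
      (length M + length M′) * q ^ m          ≡⟨ *-distribʳ-+ (q ^ m) (length M) _ ⟩
      length M * q ^ m + length M′ * q ^ m    ≤⟨ +-mono-≤ ≤p ≤p′ ⟩
      1 * p ^ m + length ws * p ^ m           ≡⟨ cong (_+ length ws * p ^ m) (*-identityˡ (p ^ m)) ⟩
      suc (length ws) * p ^ m                 ∎
    both : Lists (M ++ M′) (λ Z → Any (λ w → Q w Z) (w ∷ ws))
    both Z (here QZ)   = Any.++⁺ˡ (lists Z QZ)
    both Z (there any) = Any.++⁺ʳ M (lists′ Z any)

  -- A branching into `k` cases is paid for by `k` deleted elements, as `k` is at most
  -- `(p / q) ^ k`.
  absorb : ∀ {Q m} k → Bounded k m Q → Bounded 1 (m + k) Q
  absorb {m = m} k (bounded M ≤p lists) = bounded M bound lists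
    where
    open ≤-Reasoning
    bound : length M * q ^ (m + k) ≤ 1 * p ^ (m + k)
    bound = begin
      length M * q ^ (m + k)     ≡⟨ cong (length M *_) (^-distribˡ-+-* q m k) ⟩
      length M * (q ^ m * q ^ k) ≡⟨ sym (*-assoc (length M) _ _) ⟩
      length M * q ^ m * q ^ k   ≤⟨ *-monoˡ-≤ (q ^ k) ≤p ⟩
      k * p ^ m * q ^ k          ≡⟨ cong (_* q ^ k) (*-comm k (p ^ m)) ⟩
      p ^ m * k * q ^ k          ≡⟨ *-assoc (p ^ m) k _ ⟩
      p ^ m * (k * q ^ k)        ≤⟨ *-monoʳ-≤ (p ^ m) (k*q^k≤p^k k) ⟩
      p ^ m * p ^ k              ≡⟨ sym (^-distribˡ-+-* p m k) ⟩
      p ^ (m + k)                ≡⟨ sym (*-identityˡ _) ⟩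
      1 * p ^ (m + k)            ∎

  leastNbh : ∀ u us → let U = u ∷ us in
    ∃[ v ] v ∈ˡ U × (∀ {w} → w ∈ˡ U → length (nbh v U) ≤ length (nbh w U))
  leastNbh u us = argmin f u us , v∈U , least
    where
    f : A → ℕ
    f x = length (nbh x (u ∷ us))
    v∈U : argmin f u us ∈ˡ u ∷ us
    v∈U with argmin-sel f u us
    ... | inj₁ eq = here eq
    ... | inj₂ v∈ = there v∈
    least : ∀ {w} → w ∈ˡ u ∷ us → f (argmin f u us) ≤ f w
    least (here refl) = f[argmin]≤f[⊤] {f = f} u us
    least (there w∈)  = All.lookup (f[argmin]≤f[xs] {f = f} u us) w∈

  -- Every maximal independent set meets the closed neighbourhood of v, and deleting the
  -- closed neighbourhood of any w removes at least as many elements as that of v.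
  enumerate : ∀ fuel U → length U ≤ fuel → Bounded 1 (length U) (MaximalIndependent U)
  enumerate _ [] _ = bounded ([] ∷ []) ≤-refl λ Z mis → here (λ _ → mk⇔ (mis .sub) λ ())
  enumerate (suc fuel) U@(u ∷ us) (s≤s ≤fuel) with leastNbh u us
  ... | v , v∈U , least = subst (λ m → Bounded 1 m (MaximalIndependent U)) (length-filter-complement (v ~?_) U)
      (absorb k (weaken (collect {Q} (nbh v U) (All.tabulate branch))))
    where
    k = length (nbh v U)
    m = length (rest v U)

    Q : A → (A → Set) → Set
    Q w Z = MaximalIndependent U Z × Z w

    rest≤ : ∀ {w} → w ∈ˡ U → length (rest w U) ≤ m
    rest≤ {w} w∈U = +-cancelʳ-≤ k _ _ (begin
      length (rest w U) + k                  ≤⟨ +-monoʳ-≤ (length (rest w U)) (least w∈U) ⟩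
      length (rest w U) + length (nbh w U)   ≡⟨ length-filter-complement (w ~?_) U ⟩
      length U                               ≡⟨ sym (length-filter-complement (v ~?_) U) ⟩
      m + k                                  ∎)
      where open ≤-Reasoning

    branch : ∀ {w} → w ∈ˡ nbh v U → Bounded 1 m (Q w)
    branch {w} w∈ = insert w∈U (Bounded-weaken (rest≤ w∈U) (enumerate fuel (rest w U) shorter))
      where
      w∈U = proj₁ (∈-filter⁻ (v ~?_) {xs = U} w∈)
      shorter : length (rest w U) ≤ fuel
      shorter = ≤-trans (≤-pred (filter-notAll (¬? ∘ (w ~?_)) U (lose w∈U (λ ≁ → ≁ ~-refl)))) ≤fuel

    weaken : Bounded k m (λ Z → Any (λ w → Q w Z) (nbh v U)) → Bounded k m (MaximalIndependent U)
    weaken (bounded M ≤p lists) = bounded M ≤p λ Z mis → lists Z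
      (let z , Zz , z~v = mis .dominating v∈U
       in lose (∈-filter⁺ (v ~?_) (mis .sub Zz) (~-sym z~v)) (mis , Zz))

-- Subsets given by decidable predicates, and their sizes

module _ {n : ℕ} {P : Fin n → Set} (P? : Unary.Decidable P) where

  subset : Subset n
  subset = tabulate (does ∘ P?)

  ∈-subset⁺ : ∀ {x} → P x → x ∈ subset
  ∈-subset⁺ {x} Px = lookup⇒[]= x subset (trans (lookup∘tabulate _ x) (dec-true (P? x) Px))

  ∈-subset⁻ : ∀ {x} → x ∈ subset → P x
  ∈-subset⁻ {x} x∈ with P? x | trans (sym (lookup∘tabulate (does ∘ P?) x)) ([]=⇒lookup x∈)
  ... | yes Px | _ = Px

x∈p─q⇒x∉q : ∀ {n} {p q : Subset n} {x} → x ∈ p ─ q → x ∉ q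
x∈p─q⇒x∉q {p = _ ∷ _} {outside ∷ _} here       ()
x∈p─q⇒x∉q {p = _ ∷ _} {_ ∷ _}       (there x∈) (there x∈q) = x∈p─q⇒x∉q x∈ x∈q

x∉p-x : ∀ {n} (p : Subset n) {x} → x ∉ p - x
x∉p-x p x∈ = x∈p─q⇒x∉q {p = p} x∈ (x∈⁅x⁆ _)

x≢y⇒2≤∣p∣ : ∀ {n} {p : Subset n} {x y} → x ≢ y → x ∈ p → y ∈ p → 2 ≤ ∣ p ∣
x≢y⇒2≤∣p∣ x≢y x∈ y∈ = ≤-trans
  (s≤s (≤-trans (s≤s z≤n) (x∈p⇒∣p-x∣<∣p∣ (x∈p∧x≢y⇒x∈p-y y∈ (x≢y ∘ sym)))))
  (x∈p⇒∣p-x∣<∣p∣ x∈)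

2≤∣p∣⇒∃≢ : ∀ {n} {p : Subset n} → 2 ≤ ∣ p ∣ → ∀ x → ∃[ y ] y ∈ p × y ≢ x
2≤∣p∣⇒∃≢ {p = p} 2≤ x with any? (λ y → (y ∈? p) ×-dec ¬? (y ≟ᶠ x))
... | yes found = found
... | no  none  = contradiction
  (≤-trans 2≤ (≤-trans (p⊆q⇒∣p∣≤∣q∣ p⊆⁅x⁆) (≤-reflexive (∣⁅x⁆∣≡1 x)))) λ { (s≤s ()) }
  where
  p⊆⁅x⁆ : p ⊆ ⁅ x ⁆
  p⊆⁅x⁆ {y} y∈ with y ≟ᶠ x
  ... | yes refl = x∈⁅x⁆ x
  ... | no  y≢x  = contradiction (y , y∈ , y≢x) none

-- Reachability, sinks and knots

module _ {n : ℕ} (D : Digraph n) where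

  infix 4 _⟶_ _⟶?_
  _⟶_ : Fin n → Fin n → Set
  u ⟶ v = adj D u v ≡ true

  _⟶?_ : ∀ u v → Dec (u ⟶ v)
  u ⟶? v = adj D u v ≟ᵇ true

  ⟶-irrefl : ∀ {u} → ¬ u ⟶ u
  ⟶-irrefl {u} u⟶u with trans (sym u⟶u) (loopless D u)
  ... | ()

  out : Fin n → Subset n
  out u = subset (u ⟶?_)

  Reach-source : ∀ {X u v} → Reach D X u v → u ∈ X
  Reach-source (here u∈)     = u∈
  Reach-source (step u∈ _ _) = u∈

  Reach-target : ∀ {X u v} → Reach D X u v → v ∈ X
  Reach-target (here u∈)    = u∈
  Reach-target (step _ _ r) = Reach-target r

  Reach-trans : ∀ {X u v w} → Reach D X u v → Reach D X v w → Reach D X u w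
  Reach-trans (here _)      s = s
  Reach-trans (step u∈ a r) s = step u∈ a (Reach-trans r s)

  Reach-mono : ∀ {X Y u v} → X ⊆ Y → Reach D X u v → Reach D Y u v
  Reach-mono X⊆Y (here u∈)     = here (X⊆Y u∈)
  Reach-mono X⊆Y (step u∈ a r) = step (X⊆Y u∈) a (Reach-mono X⊆Y r)

  Reach-closed : ∀ {X K u v} → (∀ {x y} → x ∈ K → y ∈ X → x ⟶ y → y ∈ K) →
                 u ∈ K → Reach D X u v → v ∈ K
  Reach-closed closed u∈ (here _)     = u∈
  Reach-closed closed u∈ (step _ a r) = Reach-closed closed (closed u∈ (Reach-source r) a) r

  -- Cut the path at its last visit to `s`: it avoids `s` altogether, ends in `s`, or continues from
  -- an out-neighbour of `s` without returning.
  Reach-avoid : ∀ {X u v} s → Reach D X u v →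
    Reach D (X - s) u v ⊎ s ≡ v ⊎ ∃[ w ] s ⟶ w × Reach D (X - s) w v
  Reach-avoid {u = u} s (here u∈) with u ≟ᶠ s
  ... | yes refl = inj₂ (inj₁ refl)
  ... | no  u≢s  = inj₁ (here (x∈p∧x≢y⇒x∈p-y u∈ u≢s))
  Reach-avoid {u = u} s (step u∈ a r) with Reach-avoid s r
  ... | inj₂ exit = inj₂ exit
  ... | inj₁ r′ with u ≟ᶠ s
  ...   | yes refl = inj₂ (inj₂ (_ , a , r′))
  ...   | no  u≢s  = inj₁ (step (x∈p∧x≢y⇒x∈p-y u∈ u≢s) a r′)

  -- A path can be cut to a simple one, which does not return to its source.
  reach? : ∀ X u v → Dec (Reach D X u v)
  reach? X = go ∣ X ∣ X ≤-refl
    where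
    go : ∀ fuel X → ∣ X ∣ ≤ fuel → ∀ u v → Dec (Reach D X u v)
    go fuel X ≤fuel u v with u ∈? X
    ... | no u∉ = no (u∉ ∘ Reach-source)
    go zero X ≤fuel u v | yes u∈ = contradiction (<-≤-trans (x∈p⇒∣p-x∣<∣p∣ u∈) ≤fuel) λ ()
    go (suc fuel) X ≤fuel u v | yes u∈ = mapᵈ
      [ (λ { refl → here u∈ }) , (λ (_ , a , r) → step u∈ a (Reach-mono (p─q⊆p X ⁅ u ⁆) r)) ]′
      leave
      ((u ≟ᶠ v) ⊎-dec any? (λ w → (u ⟶? w) ×-dec
        go fuel (X - u) (≤-pred (<-≤-trans (x∈p⇒∣p-x∣<∣p∣ u∈) ≤fuel)) w v))
      where
      leave : Reach D X u v → u ≡ v ⊎ ∃[ w ] u ⟶ w × Reach D (X - u) w v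
      leave r with Reach-avoid u r
      ... | inj₁ r′   = contradiction (Reach-source r′) (x∉p-x X)
      ... | inj₂ exit = exit

  Sink : Subset n → Fin n → Set
  Sink X t = t ∈ X × (∀ {w} → w ∈ X → ¬ t ⟶ w)

  outNbr? : ∀ X u → Dec (∃[ w ] w ∈ X × u ⟶ w)
  outNbr? X u = any? (λ w → (w ∈? X) ×-dec (u ⟶? w))

  sink? : ∀ X → Unary.Decidable (Sink X)
  sink? X t = mapᵈ (λ (t∈ , none) → t∈ , λ w∈ a → none (_ , w∈ , a))
                   (λ (t∈ , none) → t∈ , λ (_ , w∈ , a) → none w∈ a)
                   ((t ∈? X) ×-dec ¬? (outNbr? X t))

  Reach-from-sink : ∀ {X t v} → Sink X t → Reach D X t v → t ≡ v
  Reach-from-sink _          (here _)     = refl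
  Reach-from-sink (_ , none) (step _ a r) = contradiction a (none (Reach-source r))

  Grounded : Subset n → Fin n → Set
  Grounded X v = ∃[ t ] Reach D X v t × Sink X t

  -- A knot is closed, so a path from it to a sink ends inside it. Strong connectivity then makes
  -- that sink reach a second vertex of the knot, which a sink cannot do.
  grounded⇒KnotFree : ∀ {X} → (∀ {v} → v ∈ X → Grounded X v) → KnotFree D X
  grounded⇒KnotFree {X} grounded K knot = contradiction
    (Reach-from-sink sink (strong t∈ y∈)) (y≢t ∘ sym)
    where
    open Knot knot
    open SCC scc
    u∈ = proj₂ nonempty
    g = grounded (sub u∈)
    t = proj₁ g
    sink = proj₂ (proj₂ g)
    t∈ : t ∈ K
    t∈ = Reach-closed closed u∈ (proj₁ (proj₂ g))
    other = 2≤∣p∣⇒∃≢ size t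
    y∈ = proj₁ (proj₂ other)
    y≢t = proj₂ (proj₂ other)

  -- Descend to a vertex whose set of reachable vertices is least: that set is then
  -- strongly connected and closed, hence a knot unless it consists of a sink.
  KnotFree⇒grounded : ∀ {X} → KnotFree D X → ∀ {v} → v ∈ X → Grounded X v
  KnotFree⇒grounded {X} knotFree {v} v∈ = go ∣ reachable v ∣ v∈ ≤-refl
    where
    reachable : Fin n → Subset n
    reachable u = subset (reach? X u)

    go : ∀ fuel {u} → u ∈ X → ∣ reachable u ∣ ≤ fuel → Grounded X u
    go fuel {u} u∈ ≤fuel with any? (λ w → reach? X u w ×-dec ¬? (reach? X w u))
    go zero {u} u∈ ≤fuel | yes (w , u⇝w , ¬w⇝u) =
      contradiction (≤-trans (s≤s z≤n)
        (<-≤-trans (x∈p⇒∣p-x∣<∣p∣ (∈-subset⁺ (reach? X u) u⇝w)) ≤fuel)) λ ()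
    go (suc fuel) {u} u∈ ≤fuel | yes (w , u⇝w , ¬w⇝u)
      with go fuel (Reach-target u⇝w) (≤-pred (<-≤-trans (p⊂q⇒∣p∣<∣q∣ smaller) ≤fuel))
      where
      smaller : reachable w ⊂ reachable u
      smaller = (λ x∈ → ∈-subset⁺ (reach? X u) (Reach-trans u⇝w (∈-subset⁻ (reach? X w) x∈)))
              , u , ∈-subset⁺ (reach? X u) (here u∈) , ¬w⇝u ∘ ∈-subset⁻ (reach? X w)
    ... | t , w⇝t , sink = t , Reach-trans u⇝w w⇝t , sink
    go fuel {u} u∈ ≤fuel | no allReturn with outNbr? X u
    ... | no  none         = u , here u∈ , u∈ , λ w∈ a → none (_ , w∈ , a)
    ... | yes (w , w∈ , a) = contradiction knot (knotFree K)
      where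
      K = reachable u
      K⁺ : ∀ {x} → Reach D X u x → x ∈ K
      K⁺ = ∈-subset⁺ (reach? X u)
      K⁻ : ∀ {x} → x ∈ K → Reach D X u x
      K⁻ = ∈-subset⁻ (reach? X u)
      return : ∀ {x} → Reach D X u x → Reach D X x u
      return {x} u⇝x = decidable-stable (reach? X x u) λ ¬x⇝u → allReturn (x , u⇝x , ¬x⇝u)
      knot : Knot D X K
      knot = record
        { scc = record
          { sub      = Reach-target ∘ K⁻
          ; nonempty = u , K⁺ (here u∈)
          ; strong   = λ x∈ y∈ → Reach-trans (return (K⁻ x∈)) (K⁻ y∈)
          ; maximal  = λ x∈ _ x⇝y _ → K⁺ (Reach-trans (K⁻ x∈) x⇝y)
          }
        ; size   = x≢y⇒2≤∣p∣ (λ { refl → ⟶-irrefl a }) (K⁺ (here u∈)) (K⁺ (step u∈ a (here w∈)))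
        ; closed = λ x∈ y∈ b → K⁺ (Reach-trans (K⁻ x∈) (step (Reach-target (K⁻ x∈)) b (here y∈)))
        }

  -- Structure of a minimal knot-free vertex deletion set

  module _ {S : Subset n} (minimal : MinimalKFVDS D S) where
    private
      X : Subset n
      X = ∁ S

      X⊆∁S-x : ∀ {x} → X ⊆ ∁ (S - x)
      X⊆∁S-x {x} v∈ = x∉p⇒x∈∁p (x∈∁p⇒x∉p v∈ ∘ p─q⊆p S ⁅ x ⁆)

      ∁S-x⊆x∪X : ∀ {x v} → v ∈ ∁ (S - x) → v ≡ x ⊎ v ∈ X
      ∁S-x⊆x∪X {x} {v} v∈ with v ≟ᶠ x | v ∈? S
      ... | yes v≡x | _      = inj₁ v≡x
      ... | no  v≢x | yes ∈S = contradiction (x∈p∧x≢y⇒x∈p-y ∈S v≢x) (x∈∁p⇒x∉p v∈)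
      ... | no  _   | no  ∉S = inj₂ (x∉p⇒x∈∁p ∉S)

      x∈∁S-x : ∀ {x} → x ∈ ∁ (S - x)
      x∈∁S-x = x∉p⇒x∈∁p (x∉p-x S)

      grounded : ∀ {v} → v ∈ X → Grounded X v
      grounded = KnotFree⇒grounded (proj₁ minimal)

      -- Restoring `x` adds only one vertex, so only an arc into `x` can destroy an old sink.
      sink-∁S-x : ∀ {z x} → Sink X z → ¬ z ⟶ x → Sink (∁ (S - x)) z
      sink-∁S-x (z∈ , none) z↛x = X⊆∁S-x z∈ , λ w∈ a →
        [ (λ { refl → z↛x a }) , (λ w∈X → none w∈X a) ]′ (∁S-x⊆x∪X w∈)

    -- Otherwise S - x would still be a KFVDS: a sink that is no longer one points to x.
    ¬groundedAfterRestoring : ∀ {x} → x ∈ S → ¬ Grounded (∁ (S - x)) x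
    ¬groundedAfterRestoring {x} x∈S g@(t , x⇝t , sink) =
      proj₂ minimal (S - x) (x∈p⇒p-x⊂p x∈S) (grounded⇒KnotFree ground)
      where
      ground : ∀ {v} → v ∈ ∁ (S - x) → Grounded (∁ (S - x)) v
      ground v∈ with ∁S-x⊆x∪X v∈
      ... | inj₁ refl = g
      ... | inj₂ v∈X with grounded v∈X
      ...   | z , v⇝z , zSink with z ⟶? x
      ...     | yes a = t , Reach-trans (Reach-mono X⊆∁S-x v⇝z) (step (X⊆∁S-x (proj₁ zSink)) a x⇝t) , sink
      ...     | no ¬a = z , Reach-mono X⊆∁S-x v⇝z , sink-∁S-x zSink ¬a

    -- If no sink pointed to `x`, all sinks would survive its restoration. Then `x` would be
    -- grounded, through an out-neighbour in `X` or, lacking one, as a sink itself.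
    deleted⇒outNbrOfSink : ∀ {x} → x ∈ S → ∃[ z ] Sink X z × z ⟶ x
    deleted⇒outNbrOfSink {x} x∈S = decidable-stable (any? λ z → sink? X z ×-dec (z ⟶? x)) λ none →
      ¬groundedAfterRestoring x∈S (ground none)
      where
      ground : ¬ (∃[ z ] Sink X z × z ⟶ x) → Grounded (∁ (S - x)) x
      ground none with outNbr? X x
      ... | yes (w , w∈ , a) = let z , w⇝z , zSink = grounded w∈ in
        z , step x∈∁S-x a (Reach-mono X⊆∁S-x w⇝z) , sink-∁S-x zSink (λ b → none (z , zSink , b))
      ... | no isolated = x , here x∈∁S-x , x∈∁S-x , λ w∈ a →
        [ (λ { refl → ⟶-irrefl a }) , (λ w∈X → isolated (_ , w∈X , a)) ]′ (∁S-x⊆x∪X w∈)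

    outNbrOfSink⇒deleted : ∀ {x z} → Sink X z → z ⟶ x → x ∈ S
    outNbrOfSink⇒deleted (_ , none) a = x∉∁p⇒x∈p λ x∈ → none x∈ a

    -- Restoring the last vertex of S on the path would ground it.
    reachesSinkLocally : ∀ {u z} → Sink X z → Reach D (∁ (out z)) u z → Reach D X u z
    reachesSinkLocally (z∈ , _) (here _) = here z∈
    reachesSinkLocally {u} {z} zSink (step u∈ a r) with reachesSinkLocally zSink r | u ∈? S
    ... | r′ | no  u∉S = step (x∉p⇒x∈∁p u∉S) a r′
    ... | r′ | yes u∈S = contradiction
      (z , step x∈∁S-x a (Reach-mono X⊆∁S-x r′) , sink-∁S-x zSink (x∈∁p⇒x∉p u∈ ∘ ∈-subset⁺ (z ⟶?_)))
      (¬groundedAfterRestoring u∈S)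

  -- The conflict graph and the upper bound

  -- Only `D` is mentioned, so one graph serves all minimal sets at once. Deleting `out z` stands in
  -- for deleting the unknown `S`: for a sink `z` of `D - S`, both leave the same vertices able to
  -- reach `z`.
  Dominates : Fin n → Fin n → Set
  Dominates z x = x ≡ z ⊎ z ⟶ x ⊎ Reach D (∁ (out z)) x z

  Conflict : Fin n → Fin n → Set
  Conflict x y = Dominates x y ⊎ Dominates y x

  conflict? : ∀ x y → Dec (Conflict x y)
  conflict? x y = dominates? x y ⊎-dec dominates? y x
    where
    dominates? : ∀ z x → Dec (Dominates z x)
    dominates? z x = (x ≟ᶠ z) ⊎-dec (z ⟶? x) ⊎-dec reach? (∁ (out z)) x z

  -- This recovers a minimal set from a list of the sinks that it leaves.
  outNbrsOf : List (Fin n) → Subset n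
  outNbrsOf zs = subset λ x → Any.any? (_⟶? x) zs

  module Enumeration {p q : ℕ} (q≤p : q ≤ p) (bound : ∀ k → k * q ^ k ≤ p ^ k) where
    open MaximalIndependentSets conflict? (inj₁ (inj₁ refl)) swap p q q≤p bound

    module _ {S : Subset n} (minimal : MinimalKFVDS D S) where

      -- Independence: a path between sinks in `D - out z` would already lie in `D - S`, where sinks
      -- have no arcs. Domination: a deleted vertex is an out-neighbour of some sink, and any other
      -- vertex reaches a sink `z` inside `∁ S`, which avoids `out z`.
      minimal⇒sinksMaximalIndependent : MaximalIndependent (allFin n) (Sink (∁ S))
      minimal⇒sinksMaximalIndependent = record
        { sub         = λ {x} _ → ∈-allFin x
        ; independent = λ where
            xSink ySink (inj₁ d) → sym (separated xSink ySink d)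
            xSink ySink (inj₂ d) → separated ySink xSink d
        ; dominating  = λ {x} _ → dominated x
        }
        where
        separated : ∀ {z y} → Sink (∁ S) z → Sink (∁ S) y → Dominates z y → y ≡ z
        separated _     _     (inj₁ y≡z)        = y≡z
        separated zSink ySink (inj₂ (inj₁ a))   = contradiction a (proj₂ zSink (proj₁ ySink))
        separated zSink ySink (inj₂ (inj₂ y⇝z)) =
          Reach-from-sink ySink (reachesSinkLocally minimal zSink y⇝z)

        dominated : ∀ x → ∃[ z ] Sink (∁ S) z × Conflict z x
        dominated x with x ∈? S
        ... | yes x∈S = let z , zSink , a = deleted⇒outNbrOfSink minimal x∈S in
          z , zSink , inj₁ (inj₂ (inj₁ a))
        ... | no  x∉S =
          let z , x⇝z , zSink = KnotFree⇒grounded (proj₁ minimal) (x∉p⇒x∈∁p x∉S) in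
          z , zSink , inj₁ (inj₂ (inj₂ (Reach-mono (X⊆∁out zSink) x⇝z)))
          where
          X⊆∁out : ∀ {z} → Sink (∁ S) z → ∁ S ⊆ ∁ (out z)
          X⊆∁out {z} zSink w∈ = x∉p⇒x∈∁p (proj₂ zSink w∈ ∘ ∈-subset⁻ (z ⟶?_))

      minimal≡outNbrsOfSinks : ∀ {zs} → (∀ z → Sink (∁ S) z ⇔ z ∈ˡ zs) → S ≡ outNbrsOf zs
      minimal≡outNbrsOfSinks {zs} sinks = ⊆-antisym
        (λ x∈S → let z , zSink , a = deleted⇒outNbrOfSink minimal x∈S in
          ∈-subset⁺ outOf? (lose (Equivalence.to (sinks z) zSink) a))
        (λ x∈ → let z , z∈ , a = find (∈-subset⁻ outOf? x∈) in
          outNbrOfSink⇒deleted minimal (Equivalence.from (sinks z) z∈) a)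
        where
        outOf? : ∀ x → Dec (Any (_⟶ x) zs)
        outOf? x = Any.any? (_⟶? x) zs

    -- Every entry of `L` is the out-neighbourhood of some candidate, so the distinct entries of `L`
    -- are no more numerous than the candidates.
    length-minimalKFVDS : ∀ {L} → Unique L → All (MinimalKFVDS D) L → length L * q ^ n ≤ p ^ n
    length-minimalKFVDS {L} unique minimal = begin
      length L * q ^ n                           ≤⟨ *-monoˡ-≤ (q ^ n)
        (Unique-⊆⇒length≤ unique (All.map listed minimal)) ⟩
      length (map outNbrsOf candidates) * q ^ n  ≡⟨ cong (_* q ^ n) (length-map outNbrsOf candidates) ⟩
      length candidates * q ^ n                  ≡⟨ cong (λ m → length candidates * q ^ m) (sym |V|≡n) ⟩
      length candidates * q ^ |V|                ≤⟨ few ⟩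
      1 * p ^ |V|                                ≡⟨ *-identityˡ _ ⟩
      p ^ |V|                                    ≡⟨ cong (p ^_) |V|≡n ⟩
      p ^ n                                      ∎
      where
      open ≤-Reasoning
      open Bounded (enumerate (length (allFin n)) (allFin n) ≤-refl)
      |V| = length (allFin n)
      |V|≡n : |V| ≡ n
      |V|≡n = length-tabulate _
      listed : ∀ {S} → MinimalKFVDS D S → S ∈ˡ map outNbrsOf candidates
      listed m = Any.map⁺ (Any.map (minimal≡outNbrsOfSinks m)
        (complete _ (minimal⇒sinksMaximalIndependent m)))

-- Adjoining a disjoint directed triangle

↑ˡ∈++⁺ : ∀ {m n} {t : Subset m} {S : Subset n} {i} → i ∈ t → i ↑ˡ n ∈ t Vec.++ S
↑ˡ∈++⁺ here       = here
↑ˡ∈++⁺ (there i∈) = there (↑ˡ∈++⁺ i∈)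

↑ˡ∈++⁻ : ∀ {m n} (t : Subset m) {S : Subset n} {i} → i ↑ˡ n ∈ t Vec.++ S → i ∈ t
↑ˡ∈++⁻ (_ ∷ _) {i = zero}  here       = here
↑ˡ∈++⁻ (_ ∷ t) {i = suc _} (there i∈) = there (↑ˡ∈++⁻ t i∈)

module _ {n : ℕ} (D : Digraph n) where

  addTriangle : Digraph (3 + n)
  addTriangle .adj 0F 1F = true
  addTriangle .adj 1F 2F = true
  addTriangle .adj 2F 0F = true
  addTriangle .adj (suc (suc (suc u))) (suc (suc (suc v))) = adj D u v
  addTriangle .adj _ _ = false
  addTriangle .loopless 0F = refl
  addTriangle .loopless 1F = refl
  addTriangle .loopless 2F = refl
  addTriangle .loopless (suc (suc (suc u))) = loopless D u

  private
    old : Fin n → Fin (3 + n)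
    old u = suc (suc (suc u))

    old∈ : ∀ {X u} (t : Subset 3) → u ∈ X → old u ∈ t Vec.++ X
    old∈ (_ ∷ _ ∷ _ ∷ []) u∈ = there (there (there u∈))

    old∈⁻ : ∀ {X u} (t : Subset 3) → old u ∈ t Vec.++ X → u ∈ X
    old∈⁻ (_ ∷ _ ∷ _ ∷ []) (there (there (there u∈))) = u∈

    ∁-++ : ∀ (t : Subset 3) {S : Subset n} → ∁ (t Vec.++ S) ≡ ∁ t Vec.++ ∁ S
    ∁-++ (_ ∷ _ ∷ _ ∷ []) = refl

    liftReach : ∀ {X u v} t → Reach D X u v → Reach addTriangle (t Vec.++ X) (old u) (old v)
    liftReach t (here u∈)     = here (old∈ t u∈)
    liftReach t (step u∈ a r) = step (old∈ t u∈) a (liftReach t r)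

    liftSink : ∀ {X v} t → Sink D X v → Sink addTriangle (t Vec.++ X) (old v)
    liftSink {X} {v} t (v∈ , none) = old∈ t v∈ , none′
      where
      none′ : ∀ {w} → w ∈ t Vec.++ X → ¬ adj addTriangle (old v) w ≡ true
      none′ {suc (suc (suc _))} w∈ a = none (old∈⁻ t w∈) a

    -- No arc leads from an old vertex to the triangle, so the whole path, its sink included,
    -- consists of old vertices.
    lowerGrounded : ∀ {X u} t → Grounded addTriangle (t Vec.++ X) (old u) → Grounded D X u
    lowerGrounded {X} t (v , r , sink) = go r sink
      where
      go : ∀ {u v} → Reach addTriangle (t Vec.++ X) (old u) v → Sink addTriangle (t Vec.++ X) v →
           Grounded D X u
      go (here u∈) (_ , none) = _ , here (old∈⁻ t u∈) , old∈⁻ t u∈ , λ w∈ → none (old∈ t w∈)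
      go (step {w = suc (suc (suc w))} u∈ a r) sink =
        let v , r′ , sink′ = go r sink in v , step (old∈⁻ t u∈) a r′ , sink′

    -- A path from a corner stays among the three corners `T`, and each of these keeps its outgoing
    -- arc, so no sink is reached.
    triangleIntact⇒¬KFVDS : ∀ {S} → ¬ KFVDS addTriangle (outside ∷ outside ∷ outside ∷ S)
    triangleIntact⇒¬KFVDS {S} kfvds =
      let v , r , sink = KnotFree⇒grounded addTriangle kfvds {0F} here
      in noSink (Reach-closed addTriangle (λ {x} {y} → closed {x} {y}) here r) sink
      where
      T X : Subset (3 + n)
      T = inside ∷ inside ∷ inside ∷ ⊥
      X = inside ∷ inside ∷ inside ∷ ∁ S
      closed : ∀ {x y} → x ∈ T → y ∈ X → adj addTriangle x y ≡ true → y ∈ T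
      closed {0F} {1F} _ _ _ = there here
      closed {1F} {2F} _ _ _ = there (there here)
      closed {2F} {0F} _ _ _ = here
      closed {suc (suc (suc _))} (there (there (there x∈))) = contradiction x∈ ∉⊥
      noSink : ∀ {v} → v ∈ T → ¬ Sink addTriangle X v
      noSink {0F} _ sink = proj₂ sink {1F} (there here) refl
      noSink {1F} _ sink = proj₂ sink {2F} (there (there here)) refl
      noSink {2F} _ sink = proj₂ sink {0F} here refl
      noSink {suc (suc (suc _))} (there (there (there v∈))) _ = ∉⊥ v∈

    extendKFVDS : ∀ {S} {i : Fin 3} → KFVDS D S → KFVDS addTriangle (⁅ i ⁆ Vec.++ S)
    extendKFVDS {S} {i} kfvds = grounded⇒KnotFree addTriangle (ground i)
      where
      X : Fin 3 → Subset (3 + n)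
      X i = ∁ (⁅ i ⁆ Vec.++ S)

      -- Deleting a corner turns its predecessor on the cycle into a sink, and the third corner
      -- points to that sink.
      none₂ : ∀ {w} → w ∈ X 0F → ¬ adj addTriangle 2F w ≡ true
      none₂ {0F} () _
      none₂ {1F} _ ()
      none₀ : ∀ {w} → w ∈ X 1F → ¬ adj addTriangle 0F w ≡ true
      none₀ {1F} (there ()) _
      none₁ : ∀ {w} → w ∈ X 2F → ¬ adj addTriangle 1F w ≡ true
      none₁ {2F} (there (there ())) _

      ground : ∀ i {v} → v ∈ X i → Grounded addTriangle (X i) v
      ground i {suc (suc (suc v))} v∈ rewrite ∁-++ ⁅ i ⁆ {S} =
        let t , r , sink = KnotFree⇒grounded D kfvds (old∈⁻ (∁ ⁅ i ⁆) v∈) in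
        old t , liftReach (∁ ⁅ i ⁆) r , liftSink (∁ ⁅ i ⁆) sink
      ground 0F {1F} v∈ = 2F , step v∈ refl (here (there (there here))) , there (there here) , none₂
      ground 0F {2F} v∈ = 2F , here v∈ , v∈ , none₂
      ground 1F {0F} v∈ = 0F , here v∈ , v∈ , none₀
      ground 1F {2F} v∈ = 0F , step v∈ refl (here here) , here , none₀
      ground 1F {1F} (there ())
      ground 2F {0F} v∈ = 1F , step v∈ refl (here (there here)) , there here , none₁
      ground 2F {1F} v∈ = 1F , here v∈ , v∈ , none₁
      ground 2F {2F} (there (there ()))

    restrictKFVDS : ∀ {S} t → KFVDS addTriangle (t Vec.++ S) → KFVDS D S
    restrictKFVDS {S} t kfvds = grounded⇒KnotFree D λ v∈ → lowerGrounded (∁ t)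
      (KnotFree⇒grounded addTriangle (subst (KnotFree addTriangle) (∁-++ t) kfvds) (old∈ (∁ t) v∈))

  -- A proper subset lacks an element of `S`, against the minimality of `S` in `D`, or lacks the
  -- chosen corner, which leaves the triangle intact.
  addTriangle-minimal : ∀ {S} → MinimalKFVDS D S → ∀ i → MinimalKFVDS addTriangle (⁅ i ⁆ Vec.++ S)
  addTriangle-minimal {S} (kfvds , minimal) i =
    extendKFVDS {i = i} kfvds , λ { (a ∷ b ∷ c ∷ S₁) → smaller (a ∷ b ∷ c ∷ []) S₁ }
    where
    missesCorner : ∀ t S₁ k → t Vec.++ S₁ ⊆ ⁅ i ⁆ Vec.++ S → k ↑ˡ n ∈ ⁅ i ⁆ Vec.++ S →
                   k ↑ˡ n ∉ t Vec.++ S₁ → ¬ KFVDS addTriangle (t Vec.++ S₁)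
    missesCorner t S₁ k ⊆S k∈ k∉ kf with nonempty? t
    ... | no  empty with refl ← Empty-unique empty = triangleIntact⇒¬KFVDS kf
    -- Both `j` and `k` lie in the singleton `⁅ i ⁆`, so they coincide and `k` is not missing after
    -- all.
    ... | yes (j , j∈) = k∉ (↑ˡ∈++⁺ (subst (_∈ t) (trans
      (x∈⁅y⁆⇒x≡y i (↑ˡ∈++⁻ ⁅ i ⁆ (⊆S (↑ˡ∈++⁺ j∈))))
      (sym (x∈⁅y⁆⇒x≡y i (↑ˡ∈++⁻ ⁅ i ⁆ k∈)))) j∈))

    smaller : ∀ t S₁ → t Vec.++ S₁ ⊂ ⁅ i ⁆ Vec.++ S → ¬ KFVDS addTriangle (t Vec.++ S₁)
    smaller t S₁ (⊆S , suc (suc (suc e)) , e∈ , e∉) kf = minimal S₁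
      ((λ x∈ → old∈⁻ ⁅ i ⁆ (⊆S (old∈ t x∈))) , e , old∈⁻ ⁅ i ⁆ e∈ , e∉ ∘ old∈ t)
      (restrictKFVDS t kf)
    smaller t S₁ (⊆S , 0F , e∈ , e∉) = missesCorner t S₁ 0F ⊆S e∈ e∉
    smaller t S₁ (⊆S , 1F , e∈ , e∉) = missesCorner t S₁ 1F ⊆S e∈ e∉
    smaller t S₁ (⊆S , 2F , e∈ , e∉) = missesCorner t S₁ 2F ⊆S e∈ e∉

-- Disjoint triangles and their transversals

⁅⁆-injective : ∀ {n} {x y : Fin n} → ⁅ x ⁆ ≡ ⁅ y ⁆ → x ≡ y
⁅⁆-injective {x = x} {y} eq = x∈⁅y⁆⇒x≡y y (subst (x ∈_) eq (x∈⁅x⁆ x))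

-- With the order `m * 3`, the type for `suc m` computes to `Digraph (3 + m * 3)`, as `addTriangle`
-- requires.
triangles : ∀ m → Digraph (m * 3)
triangles zero    = record { adj = λ () ; loopless = λ () }
triangles (suc m) = addTriangle (triangles m)

-- One vertex is deleted from each triangle, which gives `3 ^ m` sets.
transversals : ∀ m → List (Subset (m * 3))
transversals zero    = [] ∷ []
transversals (suc m) = cartesianProductWith (λ i S → ⁅ i ⁆ Vec.++ S) (allFin 3) (transversals m)

transversals-unique : ∀ m → Unique (transversals m)
transversals-unique zero    = [] ∷ []
transversals-unique (suc m) = Unique.cartesianProductWith⁺ _
  (λ {i} {j} eq → let ⁅i⁆≡⁅j⁆ , S≡T = ++-injective ⁅ i ⁆ ⁅ j ⁆ eq in ⁅⁆-injective ⁅i⁆≡⁅j⁆ , S≡T)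
  (Unique.allFin⁺ 3) (transversals-unique m)

transversals-minimal : ∀ m → All (MinimalKFVDS (triangles m)) (transversals m)
transversals-minimal zero    = ((λ _ knot → contradiction (SCC.nonempty (Knot.scc knot)) λ ()) , λ _ ()) ∷ []
transversals-minimal (suc m) = All.cartesianProductWith⁺ (setoid _) (setoid _)
  (λ i S → ⁅ i ⁆ Vec.++ S) (allFin 3) (transversals m)
  λ {i} _ S∈ → addTriangle-minimal (triangles m) (All.lookup (transversals-minimal m) S∈) i

length-cartesianProductWith : ∀ {A B C : Set} (f : A → B → C) xs ys →
  length (cartesianProductWith f xs ys) ≡ length xs * length ys
length-cartesianProductWith f []       ys = refl
length-cartesianProductWith f (x ∷ xs) ys = trans (length-++ (map (f x) ys))
  (cong₂ _+_ (length-map (f x) ys) (length-cartesianProductWith f xs ys))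

-- Each triangle contributes a factor `p ^ 3` on the left and `3 * q ^ 3` on the right, so any
-- `p / q` up to the cube root of 3 is admissible.
length-transversals : ∀ {p q} → p ^ 3 ≤ 3 * q ^ 3 →
                      ∀ m → p ^ (m * 3) ≤ length (transversals m) * q ^ (m * 3)
length-transversals _ zero = ≤-refl
length-transversals {p} {q} p³≤3q³ (suc m) = begin
  p ^ (3 + m * 3)                     ≡⟨ ^-distribˡ-+-* p 3 (m * 3) ⟩
  p ^ 3 * p ^ (m * 3)                 ≤⟨ *-mono-≤ p³≤3q³ (length-transversals p³≤3q³ m) ⟩
  3 * q ^ 3 * (l * q ^ (m * 3))       ≡⟨ [m*n]*[o*p]≡[m*o]*[n*p] 3 (q ^ 3) l _ ⟩
  3 * l * (q ^ 3 * q ^ (m * 3))       ≡⟨ cong₂ _*_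
    (sym (length-cartesianProductWith (λ i S → ⁅ i ⁆ Vec.++ S) (allFin 3) (transversals m)))
    (sym (^-distribˡ-+-* q 3 (m * 3))) ⟩
  length (transversals (suc m)) * q ^ (3 + m * 3) ∎
  where
  open ≤-Reasoning
  l = length (transversals m)

theorem2 : (∃[ c ] ∃[ k ] ∀ (n : ℕ) (D : Digraph n) (L : List (Subset n)) →
    Unique L → All (MinimalKFVDS D) L →
    length L * 10000 ^ n ≤ c * (suc n) ^ k * 14549 ^ n)
    ×
    (∃[ d ] ∀ (N : ℕ) → ∃[ n ] (N ≤ n × Σ (Digraph n) λ D → Σ (List (Subset n)) λ L →
    Unique L × All (MinimalKFVDS D) L × 14422 ^ n ≤ d * length L * 10000 ^ n))
theorem2 =
  -- The polynomial factor is the constant 1.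
  (1 , 0 , λ n D L unique minimal → ≤-trans
    (Enumeration.length-minimalKFVDS D q≤p k*≤ unique minimal)
    (≤-reflexive (sym (*-identityˡ (14549 ^ n))))) ,
  (1 , λ N → N * 3 , m≤m*n N 3 , triangles N , transversals N ,
    transversals-unique N , transversals-minimal N ,
    -- The rate 1.4422 lies just below the cube root of 3; the comparison of cubes is decided by
    -- evaluation.
    ≤-trans (length-transversals (from-yes (14422 ^ 3 ≤? 3 * 10000 ^ 3)) N)
      (≤-reflexive (cong (_* 10000 ^ (N * 3)) (sym (*-identityˡ (length (transversals N)))))))
  where
  q≤p : 10000 ≤ 14549
  q≤p = from-yes (10000 ≤? 14549)
  k*≤ : ∀ k → k * 10000 ^ k ≤ 14549 ^ k
  -- The critical case is `k = 3`: the `k`-th root of `k` is largest there over the integers, about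
  -- 1.4422, which is below 1.4549.
  k*≤ = k*q^k≤p^k q≤p (from-yes (2 * 10000 ^ 2 ≤? 14549 ^ 2)) (from-yes (3 * 10000 ^ 3 ≤? 14549 ^ 3))
    (from-yes (4 * 10000 ≤? 3 * 14549))
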